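{- Let $(G_m)_{m\in\mathbb{Z}}$ be a generalized Fibonacci sequence and let $n\ge 0$ be an integer. Then $$\sum_{k=0}^n G_k G_{n-k} = \frac{1}{5} \left\{ \left[ (3n+5)G_0 - (n+1)G_1 \right] G_n - \left[ (n-1)G_0 - 2nG_1 \right] G_{n+1} \right\}.$$
   Context: A generalized Fibonacci sequence is a sequence $(G_m)_{m\in\mathbb{Z}}$ of complex numbers with $G_{m+2}=G_{m+1}+G_m$ for all integers $m$ (with arbitrary seed $G_0,G_1$). -}

module Defs where

open import Algebra.Bundles using (CommutativeRing)
open import Algebra.Properties.Ring using (-1*x≈-x)
import Algebra.Solver.Ring.NaturalCoefficients.Default as SemiringSolver
open import Data.Integer.Base as ℤ using (ℤ; +_)
open import Data.Nat.Base as ℕ using (ℕ)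
import Data.Nat.Properties as ℕ
open import Data.Product.Base using (∃-syntax; _×_; _,_)
open import Data.Rational.Base as ℚ using (ℚ; 0ℚ; 1ℚ; ½; ∣_∣)
import Data.Rational.Properties as ℚ
open import Data.Rational.Solver using (module +-*-Solver)
open import Level using (0ℓ)
open import Relation.Binary.PropositionalEquality
  using (_≡_; refl; sym; trans; cong; cong₂; subst)
import Relation.Binary.Reasoning.Setoid as SetoidReasoning

------------------------------------------------------------------------
-- Estimates on rationals

private
  dist : ℚ → ℚ → ℚ
  dist p q = ∣ p ℚ.- q ∣

  ½-sum : ∀ ε → ε ℚ.* ½ ℚ.+ ε ℚ.* ½ ≡ ε
  ½-sum ε = trans (sym (ℚ.*-distribˡ-+ ε ½ ½)) (ℚ.*-identityʳ ε)

  ½-pos : ∀ {ε} → 0ℚ ℚ.< ε → 0ℚ ℚ.< ε ℚ.* ½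
  ½-pos {ε} ε>0 = subst (ℚ._< ε ℚ.* ½) (ℚ.*-zeroˡ ½) (ℚ.*-monoˡ-<-pos ½ ε>0)

  halves : ∀ {p q ε} → p ℚ.< ε ℚ.* ½ → q ℚ.< ε ℚ.* ½ → p ℚ.+ q ℚ.< ε
  halves {p} {q} {ε} p< q< = subst (p ℚ.+ q ℚ.<_) (½-sum ε) (ℚ.+-mono-< p< q<)

  dist-sym : ∀ p q → dist p q ≡ dist q p
  dist-sym p q = trans (sym (ℚ.∣-p∣≡∣p∣ (p ℚ.- q))) (cong ∣_∣ (eq p q))
    where
    open +-*-Solver
    eq : ∀ p q → ℚ.- (p ℚ.- q) ≡ q ℚ.- p
    eq = solve 2 (λ p q → :- (p :- q) := q :- p) refl

  dist-self : ∀ {p q} → p ≡ q → dist p q ≡ 0ℚ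
  dist-self {p} refl = cong ∣_∣ (ℚ.+-inverseʳ p)

  triangle : ∀ p q r → dist p r ℚ.≤ dist p q ℚ.+ dist q r
  triangle p q r = subst (λ x → ∣ x ∣ ℚ.≤ dist p q ℚ.+ dist q r) (eq p q r)
                         (ℚ.∣p+q∣≤∣p∣+∣q∣ (p ℚ.- q) (q ℚ.- r))
    where
    open +-*-Solver
    eq : ∀ p q r → (p ℚ.- q) ℚ.+ (q ℚ.- r) ≡ p ℚ.- r
    eq = solve 3 (λ p q r → (p :- q) :+ (q :- r) := p :- r) refl

  dist-neg : ∀ p q → dist (ℚ.- p) (ℚ.- q) ≡ dist p q
  dist-neg p q = trans (cong ∣_∣ (eq p q)) (ℚ.∣-p∣≡∣p∣ (p ℚ.- q))
    where
    open +-*-Solver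
    eq : ∀ p q → ℚ.- p ℚ.- ℚ.- q ≡ ℚ.- (p ℚ.- q)
    eq = solve 2 (λ p q → :- p :- :- q := :- (p :- q)) refl

  dist-+ : ∀ p q r s →
           dist (p ℚ.+ q) (r ℚ.+ s) ℚ.≤ dist p r ℚ.+ dist q s
  dist-+ p q r s = subst (λ x → ∣ x ∣ ℚ.≤ dist p r ℚ.+ dist q s) (eq p q r s)
                         (ℚ.∣p+q∣≤∣p∣+∣q∣ (p ℚ.- r) (q ℚ.- s))
    where
    open +-*-Solver
    eq : ∀ p q r s → (p ℚ.- r) ℚ.+ (q ℚ.- s) ≡ (p ℚ.+ q) ℚ.- (r ℚ.+ s)
    eq = solve 4 (λ p q r s → (p :- r) :+ (q :- s) := (p :+ q) :- (r :+ s)) refl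

  dist-* : ∀ p q r s →
           dist (p ℚ.* q) (r ℚ.* s) ℚ.≤ ∣ p ∣ ℚ.* dist q s ℚ.+ ∣ s ∣ ℚ.* dist p r
  dist-* p q r s = begin
    ∣ p ℚ.* q ℚ.- r ℚ.* s ∣                                  ≡⟨ cong ∣_∣ (eq p q r s) ⟩
    ∣ p ℚ.* (q ℚ.- s) ℚ.+ s ℚ.* (p ℚ.- r) ∣                  ≤⟨ ℚ.∣p+q∣≤∣p∣+∣q∣ (p ℚ.* (q ℚ.- s)) (s ℚ.* (p ℚ.- r)) ⟩
    ∣ p ℚ.* (q ℚ.- s) ∣ ℚ.+ ∣ s ℚ.* (p ℚ.- r) ∣              ≡⟨ cong₂ ℚ._+_ (ℚ.∣p*q∣≡∣p∣*∣q∣ p (q ℚ.- s)) (ℚ.∣p*q∣≡∣p∣*∣q∣ s (p ℚ.- r)) ⟩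
    ∣ p ∣ ℚ.* dist q s ℚ.+ ∣ s ∣ ℚ.* dist p r                ∎
    where
    open ℚ.≤-Reasoning
    open +-*-Solver
    eq : ∀ p q r s → p ℚ.* q ℚ.- r ℚ.* s ≡ p ℚ.* (q ℚ.- s) ℚ.+ s ℚ.* (p ℚ.- r)
    eq = solve 4 (λ p q r s → p :* q :- r :* s := p :* (q :- s) :+ s :* (p :- r)) refl

  *-bound : ∀ {p q b d} → 0ℚ ℚ.< b → ∣ p ∣ ℚ.< b → ∣ q ∣ ℚ.< d →
            ∣ p ∣ ℚ.* ∣ q ∣ ℚ.< b ℚ.* d
  *-bound {p} {q} {b} {d} b>0 p<b q<d = begin-strict
    ∣ p ∣ ℚ.* ∣ q ∣ ≤⟨ ℚ.*-monoʳ-≤-nonNeg ∣ q ∣ {{ℚ.nonNegative (ℚ.0≤∣p∣ q)}} (ℚ.<⇒≤ p<b) ⟩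
    b ℚ.* ∣ q ∣     <⟨ ℚ.*-monoʳ-<-pos b {{ℚ.positive b>0}} q<d ⟩
    b ℚ.* d         ∎
    where open ℚ.≤-Reasoning

  quotient : ∀ {b ε} → 0ℚ ℚ.< b → 0ℚ ℚ.< ε → ∃[ δ ] 0ℚ ℚ.< δ × b ℚ.* δ ≡ ε
  quotient {b} {ε} b>0 ε>0 = b⁻¹ ℚ.* ε
    , subst (ℚ._< b⁻¹ ℚ.* ε) (ℚ.*-zeroʳ b⁻¹)
        (ℚ.*-monoʳ-<-pos b⁻¹ {{ℚ.1/pos⇒pos b {{ℚ.positive b>0}}}} ε>0)
    , trans (sym (ℚ.*-assoc b b⁻¹ ε))
        (trans (cong (ℚ._* ε) (ℚ.*-inverseʳ b {{ℚ.pos⇒nonZero b {{ℚ.positive b>0}}}}))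
               (ℚ.*-identityˡ ε))
    where
    b⁻¹ : ℚ
    b⁻¹ = (ℚ.1/ b) {{ℚ.pos⇒nonZero b {{ℚ.positive b>0}}}}

------------------------------------------------------------------------
-- Real numbers as Cauchy sequences of rationals

-- Without eta, conversion checking never compares the cauchy proofs.
record ℝ : Set where
  no-eta-equality
  constructor mkℝ
  field
    seq    : ℕ → ℚ
    cauchy : ∀ ε → 0ℚ ℚ.< ε →
             ∃[ N ] (∀ m n → N ℕ.≤ m → N ℕ.≤ n → ∣ seq m ℚ.- seq n ∣ ℚ.< ε)

open ℝ

infix 4 _≃ᴿ_

-- Equality of reals: the difference of the sequences tends to 0.
record _≃ᴿ_ (x y : ℝ) : Set where
  constructor mk≃
  field
    close : ∀ ε → 0ℚ ℚ.< ε →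
            ∃[ N ] (∀ n → N ℕ.≤ n → ∣ seq x n ℚ.- seq y n ∣ ℚ.< ε)

open _≃ᴿ_

private
  pointwise : ∀ {x y} → (∀ n → seq x n ≡ seq y n) → x ≃ᴿ y
  pointwise eq .close ε ε>0 =
    0 , λ n _ → subst (ℚ._< ε) (sym (dist-self (eq n))) ε>0

  bounded : ∀ x → ∃[ b ] 0ℚ ℚ.< b × ∃[ N ] (∀ n → N ℕ.≤ n → ∣ seq x n ∣ ℚ.< b)
  bounded x with cauchy x 1ℚ (ℚ.positive⁻¹ 1ℚ)
  ... | N , c = 1ℚ ℚ.+ ∣ seq x N ∣
              , ℚ.+-mono-<-≤ {0ℚ} {1ℚ} (ℚ.positive⁻¹ 1ℚ) (ℚ.0≤∣p∣ (seq x N))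
              , N , bnd
    where
    open ℚ.≤-Reasoning
    open +-*-Solver
    eq : ∀ p q → p ≡ (p ℚ.- q) ℚ.+ q
    eq = solve 2 (λ p q → p := (p :- q) :+ q) refl
    bnd : ∀ n → N ℕ.≤ n → ∣ seq x n ∣ ℚ.< 1ℚ ℚ.+ ∣ seq x N ∣
    bnd n N≤n = begin-strict
      ∣ seq x n ∣                             ≡⟨ cong ∣_∣ (eq (seq x n) (seq x N)) ⟩
      ∣ (seq x n ℚ.- seq x N) ℚ.+ seq x N ∣   ≤⟨ ℚ.∣p+q∣≤∣p∣+∣q∣ (seq x n ℚ.- seq x N) (seq x N) ⟩
      dist (seq x n) (seq x N) ℚ.+ ∣ seq x N ∣ <⟨ ℚ.+-monoˡ-< ∣ seq x N ∣ (c n N N≤n ℕ.≤-refl) ⟩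
      1ℚ ℚ.+ ∣ seq x N ∣                      ∎

  ⊔-left : ∀ M {N n} → M ℕ.⊔ N ℕ.≤ n → M ℕ.≤ n
  ⊔-left M {N} le = ℕ.≤-trans (ℕ.m≤m⊔n M N) le

  ⊔-right : ∀ M {N n} → M ℕ.⊔ N ℕ.≤ n → N ℕ.≤ n
  ⊔-right M {N} le = ℕ.≤-trans (ℕ.m≤n⊔m M N) le

  *-close : ∀ {b c d ε} p q r s → 0ℚ ℚ.< b → 0ℚ ℚ.< c →
            (b ℚ.* d ≡ ε ℚ.* ½) → ∀ {e} → (c ℚ.* e ≡ ε ℚ.* ½) →
            ∣ p ∣ ℚ.< b → ∣ s ∣ ℚ.< c → dist q s ℚ.< d → dist p r ℚ.< e →
            dist (p ℚ.* q) (r ℚ.* s) ℚ.< ε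
  *-close {b} {c} p q r s b>0 c>0 bd ce p<b s<c qs pr = ℚ.≤-<-trans (dist-* p q r s)
    (halves (subst (∣ p ∣ ℚ.* dist q s ℚ.<_) bd (*-bound {p} {q ℚ.- s} b>0 p<b qs))
            (subst (∣ s ∣ ℚ.* dist p r ℚ.<_) ce (*-bound {s} {p ℚ.- r} c>0 s<c pr)))

fromℚᴿ : ℚ → ℝ
fromℚᴿ q .seq _ = q
fromℚᴿ q .cauchy ε ε>0 =
  0 , λ _ _ _ _ → subst (ℚ._< ε) (sym (dist-self {q} refl)) ε>0

infixl 6 _+ᴿ_
infixl 7 _*ᴿ_
infix  8 -ᴿ_

_+ᴿ_ : ℝ → ℝ → ℝ
(x +ᴿ y) .seq n = seq x n ℚ.+ seq y n
(x +ᴿ y) .cauchy ε ε>0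
  with cauchy x (ε ℚ.* ½) (½-pos ε>0) | cauchy y (ε ℚ.* ½) (½-pos ε>0)
... | M , p | N , q = M ℕ.⊔ N , λ m n ≤m ≤n →
  ℚ.≤-<-trans (dist-+ (seq x m) (seq y m) (seq x n) (seq y n))
    (halves (p m n (⊔-left M ≤m) (⊔-left M ≤n)) (q m n (⊔-right M ≤m) (⊔-right M ≤n)))

-ᴿ_ : ℝ → ℝ
(-ᴿ x) .seq n = ℚ.- seq x n
(-ᴿ x) .cauchy ε ε>0 with cauchy x ε ε>0
... | N , p = N , λ m n ≤m ≤n →
  subst (ℚ._< ε) (sym (dist-neg (seq x m) (seq x n))) (p m n ≤m ≤n)

_*ᴿ_ : ℝ → ℝ → ℝ
(x *ᴿ y) .seq n = seq x n ℚ.* seq y n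
(x *ᴿ y) .cauchy ε ε>0 =
  let b , b>0 , K , xb = bounded x
      c , c>0 , L , yc = bounded y
      d , d>0 , bd = quotient b>0 (½-pos ε>0)
      e , e>0 , ce = quotient c>0 (½-pos ε>0)
      M , p = cauchy y d d>0
      N , q = cauchy x e e>0
  in (K ℕ.⊔ L) ℕ.⊔ (M ℕ.⊔ N) , λ m n ≤m ≤n →
  *-close (seq x m) (seq y m) (seq x n) (seq y n) b>0 c>0 bd ce
    (xb m (⊔-left K (⊔-left (K ℕ.⊔ L) ≤m)))
    (yc n (⊔-right K (⊔-left (K ℕ.⊔ L) ≤n)))
    (p m n (⊔-left M (⊔-right (K ℕ.⊔ L) ≤m)) (⊔-left M (⊔-right (K ℕ.⊔ L) ≤n)))
    (q m n (⊔-right M (⊔-right (K ℕ.⊔ L) ≤m)) (⊔-right M (⊔-right (K ℕ.⊔ L) ≤n)))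

private
  ≃-sym : ∀ {x y} → x ≃ᴿ y → y ≃ᴿ x
  ≃-sym {x} {y} x≃y .close ε ε>0 with close x≃y ε ε>0
  ... | N , p = N , λ n ≤n → subst (ℚ._< ε) (dist-sym (seq x n) (seq y n)) (p n ≤n)

  ≃-trans : ∀ {x y z} → x ≃ᴿ y → y ≃ᴿ z → x ≃ᴿ z
  ≃-trans {x} {y} {z} x≃y y≃z .close ε ε>0
    with close x≃y (ε ℚ.* ½) (½-pos ε>0) | close y≃z (ε ℚ.* ½) (½-pos ε>0)
  ... | M , p | N , q = M ℕ.⊔ N , λ n ≤n →
    ℚ.≤-<-trans (triangle (seq x n) (seq y n) (seq z n))
      (halves (p n (⊔-left M ≤n)) (q n (⊔-right M ≤n)))

  +ᴿ-cong : ∀ {x y u v} → x ≃ᴿ y → u ≃ᴿ v → x +ᴿ u ≃ᴿ y +ᴿ v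
  +ᴿ-cong {x} {y} {u} {v} x≃y u≃v .close ε ε>0
    with close x≃y (ε ℚ.* ½) (½-pos ε>0) | close u≃v (ε ℚ.* ½) (½-pos ε>0)
  ... | M , p | N , q = M ℕ.⊔ N , λ n ≤n →
    ℚ.≤-<-trans (dist-+ (seq x n) (seq u n) (seq y n) (seq v n))
      (halves (p n (⊔-left M ≤n)) (q n (⊔-right M ≤n)))

  -ᴿ-cong : ∀ {x y} → x ≃ᴿ y → -ᴿ x ≃ᴿ -ᴿ y
  -ᴿ-cong {x} {y} x≃y .close ε ε>0 with close x≃y ε ε>0
  ... | N , p = N , λ n ≤n →
    subst (ℚ._< ε) (sym (dist-neg (seq x n) (seq y n))) (p n ≤n)

  *ᴿ-cong : ∀ {x y u v} → x ≃ᴿ y → u ≃ᴿ v → x *ᴿ u ≃ᴿ y *ᴿ v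
  *ᴿ-cong {x} {y} {u} {v} x≃y u≃v .close ε ε>0 =
    let b , b>0 , K , xb = bounded x
        c , c>0 , L , vc = bounded v
        d , d>0 , bd = quotient b>0 (½-pos ε>0)
        e , e>0 , ce = quotient c>0 (½-pos ε>0)
        M , p = close u≃v d d>0
        N , q = close x≃y e e>0
    in (K ℕ.⊔ L) ℕ.⊔ (M ℕ.⊔ N) , λ n ≤n →
    *-close (seq x n) (seq u n) (seq y n) (seq v n) b>0 c>0 bd ce
      (xb n (⊔-left K (⊔-left (K ℕ.⊔ L) ≤n)))
      (vc n (⊔-right K (⊔-left (K ℕ.⊔ L) ≤n)))
      (p n (⊔-left M (⊔-right (K ℕ.⊔ L) ≤n)))
      (q n (⊔-right M (⊔-right (K ℕ.⊔ L) ≤n)))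

ℝ-commutativeRing : CommutativeRing 0ℓ 0ℓ
ℝ-commutativeRing = record
  { Carrier = ℝ
  ; _≈_     = _≃ᴿ_
  ; _+_     = _+ᴿ_
  ; _*_     = _*ᴿ_
  ; -_      = -ᴿ_
  ; 0#      = fromℚᴿ 0ℚ
  ; 1#      = fromℚᴿ 1ℚ
  ; isCommutativeRing = record
    { isRing = record
      { +-isAbelianGroup = record
        { isGroup = record
          { isMonoid = record
            { isSemigroup = record
              { isMagma = record
                { isEquivalence = record
                  { refl  = pointwise (λ _ → refl)
                  ; sym   = ≃-sym
                  ; trans = ≃-trans
                  }
                ; ∙-cong = +ᴿ-cong
                }
              ; assoc = λ x y z → pointwise (λ n → ℚ.+-assoc (seq x n) (seq y n) (seq z n))
              }
            ; identity = (λ x → pointwise (λ n → ℚ.+-identityˡ (seq x n)))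
                       , (λ x → pointwise (λ n → ℚ.+-identityʳ (seq x n)))
            }
          ; inverse = (λ x → pointwise (λ n → ℚ.+-inverseˡ (seq x n)))
                    , (λ x → pointwise (λ n → ℚ.+-inverseʳ (seq x n)))
          ; ⁻¹-cong = -ᴿ-cong
          }
        ; comm = λ x y → pointwise (λ n → ℚ.+-comm (seq x n) (seq y n))
        }
      ; *-cong     = *ᴿ-cong
      ; *-assoc    = λ x y z → pointwise (λ n → ℚ.*-assoc (seq x n) (seq y n) (seq z n))
      ; *-identity = (λ x → pointwise (λ n → ℚ.*-identityˡ (seq x n)))
                   , (λ x → pointwise (λ n → ℚ.*-identityʳ (seq x n)))
      ; distrib    = (λ x y z → pointwise (λ n → ℚ.*-distribˡ-+ (seq x n) (seq y n) (seq z n)))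
                   , (λ x y z → pointwise (λ n → ℚ.*-distribʳ-+ (seq x n) (seq y n) (seq z n)))
      }
    ; *-comm = λ x y → pointwise (λ n → ℚ.*-comm (seq x n) (seq y n))
    }
  }

------------------------------------------------------------------------
-- Adjoining a square root i of -1 to a commutative ring

module AdjoinI {c ℓ} (R : CommutativeRing c ℓ) where
  private
    module R = CommutativeRing R

    -- The ring laws of R[i] as semiring identities over R, with j for -1.
    module Laws where
      open R hiding (refl; sym; trans)
      open SemiringSolver R.commutativeSemiring

      j : Carrier
      j = - 1#

      sub : ∀ x y → x - y ≈ x + j * y
      sub x y = +-congˡ (R.sym (-1*x≈-x R.ring y))

      assoc-re : ∀ a b c d e f →
        (a * c - b * d) * e - (a * d + b * c) * f ≈
        a * (c * e - d * f) - b * (c * f + d * e)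
      assoc-re a b c d e f = begin
        (a * c - b * d) * e - (a * d + b * c) * f         ≈⟨ sub _ _ ⟩
        (a * c - b * d) * e + j * ((a * d + b * c) * f)   ≈⟨ +-congʳ (*-congʳ (sub _ _)) ⟩
        (a * c + j * (b * d)) * e + j * ((a * d + b * c) * f)
          ≈⟨ solve 7 (λ j a b c d e f →
               (a :* c :+ j :* (b :* d)) :* e :+ j :* ((a :* d :+ b :* c) :* f) :=
               a :* (c :* e :+ j :* (d :* f)) :+ j :* (b :* (c :* f :+ d :* e)))
               R.refl j a b c d e f ⟩
        a * (c * e + j * (d * f)) + j * (b * (c * f + d * e))
          ≈⟨ +-congʳ (*-congˡ (sub _ _)) ⟨
        a * (c * e - d * f) + j * (b * (c * f + d * e))   ≈⟨ sub _ _ ⟨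
        a * (c * e - d * f) - b * (c * f + d * e)         ∎
        where open SetoidReasoning R.setoid

      assoc-im : ∀ a b c d e f →
        (a * c - b * d) * f + (a * d + b * c) * e ≈
        a * (c * f + d * e) + b * (c * e - d * f)
      assoc-im a b c d e f = begin
        (a * c - b * d) * f + (a * d + b * c) * e         ≈⟨ +-congʳ (*-congʳ (sub _ _)) ⟩
        (a * c + j * (b * d)) * f + (a * d + b * c) * e
          ≈⟨ solve 7 (λ j a b c d e f →
               (a :* c :+ j :* (b :* d)) :* f :+ (a :* d :+ b :* c) :* e :=
               a :* (c :* f :+ d :* e) :+ b :* (c :* e :+ j :* (d :* f)))
               R.refl j a b c d e f ⟩
        a * (c * f + d * e) + b * (c * e + j * (d * f))   ≈⟨ +-congˡ (*-congˡ (sub _ _)) ⟨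
        a * (c * f + d * e) + b * (c * e - d * f)         ∎
        where open SetoidReasoning R.setoid

      comm-re : ∀ a b c d → a * c - b * d ≈ c * a - d * b
      comm-re a b c d = +-cong (*-comm a c) (-‿cong (*-comm b d))

      comm-im : ∀ a b c d → a * d + b * c ≈ c * b + d * a
      comm-im a b c d = R.trans (+-comm (a * d) (b * c)) (+-cong (*-comm b c) (*-comm a d))

      distribˡ-re : ∀ a b c d e f →
        a * (c + e) - b * (d + f) ≈ (a * c - b * d) + (a * e - b * f)
      distribˡ-re a b c d e f = begin
        a * (c + e) - b * (d + f)                            ≈⟨ sub _ _ ⟩
        a * (c + e) + j * (b * (d + f))
          ≈⟨ solve 7 (λ j a b c d e f →
               a :* (c :+ e) :+ j :* (b :* (d :+ f)) :=
               (a :* c :+ j :* (b :* d)) :+ (a :* e :+ j :* (b :* f)))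
               R.refl j a b c d e f ⟩
        (a * c + j * (b * d)) + (a * e + j * (b * f))        ≈⟨ +-cong (sub _ _) (sub _ _) ⟨
        (a * c - b * d) + (a * e - b * f)                    ∎
        where open SetoidReasoning R.setoid

      distribˡ-im : ∀ a b c d e f →
        a * (d + f) + b * (c + e) ≈ (a * d + b * c) + (a * f + b * e)
      distribˡ-im = solve 6 (λ a b c d e f →
        a :* (d :+ f) :+ b :* (c :+ e) := (a :* d :+ b :* c) :+ (a :* f :+ b :* e)) R.refl

  open R using (0#; 1#)

  infix 5 _+i_

  record R[i] : Set c where
    constructor _+i_
    field
      re im : R.Carrier

  open R[i]

  infix 4 _≈_

  record _≈_ (z w : R[i]) : Set ℓ where
    constructor _,_
    field
      re≈ : re z R.≈ re w
      im≈ : im z R.≈ im w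

  open _≈_

  infixl 6 _+_
  infixl 7 _*_
  infix  8 -_

  _+_ : R[i] → R[i] → R[i]
  z + w = (re z R.+ re w) +i (im z R.+ im w)

  -_ : R[i] → R[i]
  - z = (R.- re z) +i (R.- im z)

  _*_ : R[i] → R[i] → R[i]
  z * w = (re z R.* re w R.- im z R.* im w) +i (re z R.* im w R.+ im z R.* re w)

  private
    *-comm : ∀ z w → z * w ≈ w * z
    *-comm (a +i b) (c +i d) = Laws.comm-re a b c d , Laws.comm-im a b c d

    *-identityˡ : ∀ z → (1# +i 0#) * z ≈ z
    *-identityˡ (a +i b)
      = R.trans (R.+-cong (R.*-identityˡ a) (R.trans (R.-‿cong (R.zeroˡ b)) -0≈0)) (R.+-identityʳ a)
      , R.trans (R.+-cong (R.*-identityˡ b) (R.zeroˡ a)) (R.+-identityʳ b)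
      where
      -0≈0 : R.- 0# R.≈ 0#
      -0≈0 = R.trans (R.sym (R.+-identityˡ (R.- 0#))) (R.-‿inverseʳ 0#)

    distribˡ : ∀ z w v → z * (w + v) ≈ z * w + z * v
    distribˡ (a +i b) (c +i d) (e +i f) = Laws.distribˡ-re a b c d e f , Laws.distribˡ-im a b c d e f

    ≈-trans : ∀ {z w v} → z ≈ w → w ≈ v → z ≈ v
    ≈-trans p q = R.trans (re≈ p) (re≈ q) , R.trans (im≈ p) (im≈ q)

    +-cong : ∀ {z w u v} → z ≈ w → u ≈ v → z + u ≈ w + v
    +-cong p q = R.+-cong (re≈ p) (re≈ q) , R.+-cong (im≈ p) (im≈ q)

  R[i]-commutativeRing : CommutativeRing c ℓ
  R[i]-commutativeRing = record
    { Carrier = R[i]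
    ; _≈_     = _≈_
    ; _+_     = _+_
    ; _*_     = _*_
    ; -_      = -_
    ; 0#      = 0# +i 0#
    ; 1#      = 1# +i 0#
    ; isCommutativeRing = record
      { isRing = record
        { +-isAbelianGroup = record
          { isGroup = record
            { isMonoid = record
              { isSemigroup = record
                { isMagma = record
                  { isEquivalence = record
                    { refl  = R.refl , R.refl
                    ; sym   = λ p → R.sym (re≈ p) , R.sym (im≈ p)
                    ; trans = ≈-trans
                    }
                  ; ∙-cong = +-cong
                  }
                ; assoc = λ z w v → R.+-assoc (re z) (re w) (re v) , R.+-assoc (im z) (im w) (im v)
                }
              ; identity = (λ z → R.+-identityˡ (re z) , R.+-identityˡ (im z))
                         , (λ z → R.+-identityʳ (re z) , R.+-identityʳ (im z))
              }
            ; inverse = (λ z → R.-‿inverseˡ (re z) , R.-‿inverseˡ (im z))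
                      , (λ z → R.-‿inverseʳ (re z) , R.-‿inverseʳ (im z))
            ; ⁻¹-cong = λ p → R.-‿cong (re≈ p) , R.-‿cong (im≈ p)
            }
          ; comm = λ z w → R.+-comm (re z) (re w) , R.+-comm (im z) (im w)
          }
        ; *-cong = λ p q →
            R.+-cong (R.*-cong (re≈ p) (re≈ q)) (R.-‿cong (R.*-cong (im≈ p) (im≈ q)))
          , R.+-cong (R.*-cong (re≈ p) (im≈ q)) (R.*-cong (im≈ p) (re≈ q))
        ; *-assoc = λ (a +i b) (c +i d) (e +i f) →
            Laws.assoc-re a b c d e f , Laws.assoc-im a b c d e f
        ; *-identity = *-identityˡ
                     , λ z → ≈-trans (*-comm z (1# +i 0#)) (*-identityˡ z)
        ; distrib = distribˡ
                  , λ z w v → ≈-trans (*-comm (w + v) z)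
                      (≈-trans (distribˡ z w v) (+-cong (*-comm z w) (*-comm z v)))
        }
      ; *-comm = *-comm
      }
    }

------------------------------------------------------------------------
-- Complex numbers

open AdjoinI ℝ-commutativeRing using (_+i_; R[i]-commutativeRing)

ℂ-commutativeRing : CommutativeRing 0ℓ 0ℓ
ℂ-commutativeRing = R[i]-commutativeRing

open CommutativeRing ℂ-commutativeRing public
  using (_≈_; _+_; _*_; _-_; -_)
  renaming (Carrier to ℂ; semiring to ℂ-semiring)

open import Algebra.Properties.Semiring.Sum ℂ-semiring public
  using (sum⁺-syntax)

fromℚ : ℚ → ℂ
fromℚ q = fromℚᴿ q +i fromℚᴿ 0ℚ

fromℤ : ℤ → ℂ
fromℤ z = fromℚ (z ℚ./ 1)

------------------------------------------------------------------------
-- Generalized Fibonacci sequences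

IsGeneralizedFibonacci : (ℤ → ℂ) → Set
IsGeneralizedFibonacci G =
  ∀ m → G (m ℤ.+ + 2) ≈ G (m ℤ.+ + 1) + G m

{-# OPTIONS --safe #-}

-- The convolution S(n) = Σ G_k G_{n-k} satisfies the inhomogeneous recurrence
-- S(n+2) = S(n+1) + S(n) + G_0 G_n + G_1 G_{n+1}; the expression in braces
-- satisfies five times this recurrence and agrees with 5 S(n) at n = 0, 1.

module Submission where

open import Defs
open import Algebra.Bundles using (CommutativeRing)
import Algebra.Properties.Semiring.Sum as SemiringSum
import Algebra.Solver.Ring as RingSolver
open import Algebra.Solver.Ring.AlmostCommutativeRing
  using (fromCommutativeRing; _-Raw-AlmostCommutative⟶_)
open import Data.Fin.Base using (toℕ)
open import Data.Fin.Properties using (toℕ≤pred[n])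
open import Data.Integer.Base as ℤ using (ℤ; +_; -[1+_])
import Data.Integer.Properties as ℤ
open import Data.Integer.Solver using (module +-*-Solver)
open import Data.Maybe.Base using (map)
open import Data.Nat.Base as ℕ using (ℕ; zero; suc; _∸_)
import Data.Nat.Properties as ℕ
open import Data.Product.Base using (_,_)
open import Data.Rational.Base as ℚ using ()
import Data.Rational.Properties as ℚ
import Data.Rational.Unnormalised.Base as ℚᵘ
import Data.Rational.Unnormalised.Properties as ℚᵘ
open import Function.Base using (_∘_)
open import Relation.Binary.Consequences using (dec⇒weaklyDec)
open import Relation.Binary.PropositionalEquality as ≡ using (_≡_)
import Relation.Binary.Reasoning.Setoid as SetoidReasoning

-- Self-convolution of Fibonacci sequences over an abstract commutative ring

module Convolution
  {c ℓ} (R : CommutativeRing c ℓ)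
  (morphism : ℤ.+-*-rawRing -Raw-AlmostCommutative⟶ fromCommutativeRing R)
  where

  open CommutativeRing R renaming
    (Carrier to A; _≈_ to _≈ᴿ_; _+_ to _⊕_; _*_ to _⊛_; _-_ to _⊖_; -_ to ⊝_)
  open SemiringSum semiring using (∑-distrib-+; sum-cong-≋) renaming (sum⁺-syntax to ∑⁺)
  open _-Raw-AlmostCommutative⟶_ morphism using (+-homo; *-homo) renaming (⟦_⟧ to φ)
  -- Integer coefficients give the solver a decidable equality; `R` itself, later the complex
  -- numbers, need not have one.
  open RingSolver ℤ.+-*-rawRing (fromCommutativeRing R) morphism
    (λ i j → map (reflexive ∘ ≡.cong φ) (dec⇒weaklyDec ℤ._≟_ i j))
  open SetoidReasoning setoid

  -- Two sequences are allowed because the recurrence shifts the first factor alone. The index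
  -- satisfies `toℕ k` ≤ `n`, so `∸` never truncates.
  conv : (ℕ → A) → (ℕ → A) → ℕ → A
  conv g h n = ∑⁺ n λ k → g (toℕ k) ⊛ h (n ∸ toℕ k)

  IsFibonacci : (ℕ → A) → Set ℓ
  IsFibonacci g = ∀ n → g (2 ℕ.+ n) ≈ᴿ g (1 ℕ.+ n) ⊕ g n

  -- Peel off the terms k = 0 and k = 1. In the remaining terms `g` is shifted by two, so its
  -- recurrence splits them into two shorter convolutions.
  conv-recurrence : ∀ {g h} → IsFibonacci g → IsFibonacci h → ∀ n →
    conv g h (2 ℕ.+ n) ≈ᴿ
    conv g h (1 ℕ.+ n) ⊕ conv g h n ⊕ (g 0 ⊛ h n ⊕ g 1 ⊛ h (1 ℕ.+ n))
  conv-recurrence {g} {h} g-fib h-fib n = begin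
    g 0 ⊛ h (2 ℕ.+ n) ⊕ (g 1 ⊛ h (1 ℕ.+ n) ⊕ conv (g ∘ (2 ℕ.+_)) h n)
      ≈⟨ +-cong (*-congˡ (h-fib n)) (+-congˡ split) ⟩
    g 0 ⊛ (h (1 ℕ.+ n) ⊕ h n) ⊕ (g 1 ⊛ h (1 ℕ.+ n) ⊕ (conv (g ∘ suc) h n ⊕ conv g h n))
      -- The summand `a :* q :+ t` is `conv g h (1 ℕ.+ n)` with its k = 0 term exposed.
      ≈⟨ solve 6 (λ a b p q s t →
           a :* (q :+ p) :+ (b :* q :+ (t :+ s)) :=
           a :* q :+ t :+ s :+ (a :* p :+ b :* q))
         refl (g 0) (g 1) (h n) (h (1 ℕ.+ n)) (conv g h n) (conv (g ∘ suc) h n) ⟩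
    conv g h (1 ℕ.+ n) ⊕ conv g h n ⊕ (g 0 ⊛ h n ⊕ g 1 ⊛ h (1 ℕ.+ n)) ∎
    where
    split : conv (g ∘ (2 ℕ.+_)) h n ≈ᴿ conv (g ∘ suc) h n ⊕ conv g h n
    split = trans
      (sum-cong-≋ {n = suc n} λ k →
        trans (*-congʳ (g-fib (toℕ k))) (distribʳ (h (n ∸ toℕ k)) _ _))
      (∑-distrib-+ {n = suc n} (λ k → g (suc (toℕ k)) ⊛ h (n ∸ toℕ k))
                               (λ k → g (toℕ k) ⊛ h (n ∸ toℕ k)))

  -- The coefficients are computed in ℤ before `φ` is applied, as in the theorem; `p` and `q` stand
  -- for the terms of index n and n + 1.
  closedForm : ℕ → A → A → A → A → A
  closedForm n a b p q =
      (φ (+ 3 ℤ.* + n ℤ.+ + 5) ⊛ a ⊖ φ (+ n ℤ.+ + 1) ⊛ b) ⊛ p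
    ⊖ (φ (+ n ℤ.- + 1) ⊛ a ⊖ φ (+ 2 ℤ.* + n) ⊛ b) ⊛ q

  -- The solver needs the image of n as a variable `ν`. The constant `-[1+ 0 ]` appears because
  -- `+ n ℤ.- + 1` unfolds to adding it.
  closedPolynomial : ∀ {k} (ν a b p q : Polynomial k) → Polynomial k
  closedPolynomial ν a b p q =
       ((con (+ 3) :* ν :+ con (+ 5)) :* a :- (ν :+ con (+ 1)) :* b) :* p
    :- ((ν :+ con -[1+ 0 ]) :* a :- con (+ 2) :* ν :* b) :* q

  closedFormAt : A → A → A → A → A → A
  closedFormAt ν a b p q =
      ((φ (+ 3) ⊛ ν ⊕ φ (+ 5)) ⊛ a ⊖ (ν ⊕ φ (+ 1)) ⊛ b) ⊛ p
    ⊖ ((ν ⊕ φ -[1+ 0 ]) ⊛ a ⊖ φ (+ 2) ⊛ ν ⊛ b) ⊛ q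

  -- Pushes `φ` through the coefficients to reach the value of `closedPolynomial`. Leaving `ν` free
  -- lets a shifted index enter as `φ (+ 2) ⊕ φ (+ n)`.
  closedForm≈closedFormAt : ∀ {n ν} → φ (+ n) ≈ᴿ ν → ∀ a b p q →
    closedForm n a b p q ≈ᴿ closedFormAt ν a b p q
  closedForm≈closedFormAt {n} n≈ν a b p q = +-cong
    (*-congʳ (+-cong
      (*-congʳ (trans (+-homo (+ 3 ℤ.* + n) (+ 5))
                      (+-congʳ (trans (*-homo (+ 3) (+ n)) (*-congˡ n≈ν)))))
      (-‿cong (*-congʳ (trans (+-homo (+ n) (+ 1)) (+-congʳ n≈ν))))))
    (-‿cong (*-congʳ (+-cong
      (*-congʳ (trans (+-homo (+ n) -[1+ 0 ]) (+-congʳ n≈ν)))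
      (-‿cong (*-congʳ (trans (*-homo (+ 2) (+ n)) (*-congˡ n≈ν)))))))

  closedForm-cong : ∀ n a b {p p′ q q′} → p ≈ᴿ p′ → q ≈ᴿ q′ →
    closedForm n a b p q ≈ᴿ closedForm n a b p′ q′
  closedForm-cong n a b p≈p′ q≈q′ = +-cong (*-congˡ p≈p′) (-‿cong (*-congˡ q≈q′))

  -- With the later terms already written through `p` and `q`, this is a polynomial identity in five
  -- independent variables.
  closedForm-recurrence : ∀ n a b p q →
    closedForm (2 ℕ.+ n) a b (q ⊕ p) ((q ⊕ p) ⊕ q) ≈ᴿ
      closedForm (1 ℕ.+ n) a b q (q ⊕ p) ⊕ closedForm n a b p q
    ⊕ φ (+ 5) ⊛ (a ⊛ p ⊕ b ⊛ q)
  closedForm-recurrence n a b p q = begin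
    closedForm (2 ℕ.+ n) a b (q ⊕ p) ((q ⊕ p) ⊕ q)
      ≈⟨ closedForm≈closedFormAt (+-homo (+ 2) (+ n)) a b (q ⊕ p) ((q ⊕ p) ⊕ q) ⟩
    _ ≈⟨ solve 5 (λ ν a b p q →
           closedPolynomial (con (+ 2) :+ ν) a b (q :+ p) ((q :+ p) :+ q) :=
              closedPolynomial (con (+ 1) :+ ν) a b q (q :+ p) :+ closedPolynomial ν a b p q
           :+ con (+ 5) :* (a :* p :+ b :* q))
         refl (φ (+ n)) a b p q ⟩
    _ ≈⟨ +-congʳ (+-cong
           (closedForm≈closedFormAt (+-homo (+ 1) (+ n)) a b q (q ⊕ p))
           (closedForm≈closedFormAt refl a b p q)) ⟨
      closedForm (1 ℕ.+ n) a b q (q ⊕ p) ⊕ closedForm n a b p q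
    ⊕ φ (+ 5) ⊛ (a ⊛ p ⊕ b ⊛ q) ∎

  -- Two-step induction, since both sides obey the same second-order recurrence. The factor 5 stays
  -- on the left to avoid division in `R`.
  5*conv≈closedForm : ∀ {g} → IsFibonacci g → ∀ n →
    φ (+ 5) ⊛ conv g g n ≈ᴿ closedForm n (g 0) (g 1) (g n) (g (1 ℕ.+ n))
  5*conv≈closedForm {g} g-fib zero = begin
    φ (+ 5) ⊛ (g 0 ⊛ g 0 ⊕ 0#)
      ≈⟨ *-congˡ (+-identityʳ _) ⟩
    φ (+ 5) ⊛ (g 0 ⊛ g 0)
      ≈⟨ solve 2 (λ a b → con (+ 5) :* (a :* a) := closedPolynomial (con (+ 0)) a b a b)
         refl (g 0) (g 1) ⟩
    _ ≈⟨ closedForm≈closedFormAt {0} refl (g 0) (g 1) (g 0) (g 1) ⟨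
    closedForm 0 (g 0) (g 1) (g 0) (g 1) ∎
  5*conv≈closedForm {g} g-fib (suc zero) = begin
    φ (+ 5) ⊛ (g 0 ⊛ g 1 ⊕ (g 1 ⊛ g 0 ⊕ 0#))
      ≈⟨ *-congˡ (+-congˡ (+-identityʳ _)) ⟩
    φ (+ 5) ⊛ (g 0 ⊛ g 1 ⊕ g 1 ⊛ g 0)
      ≈⟨ solve 2 (λ a b → con (+ 5) :* (a :* b :+ b :* a) :=
                          closedPolynomial (con (+ 1)) a b b (b :+ a))
         refl (g 0) (g 1) ⟩
    _ ≈⟨ closedForm≈closedFormAt {1} refl (g 0) (g 1) (g 1) (g 1 ⊕ g 0) ⟨
    closedForm 1 (g 0) (g 1) (g 1) (g 1 ⊕ g 0)
      ≈⟨ closedForm-cong 1 (g 0) (g 1) refl (g-fib 0) ⟨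
    closedForm 1 (g 0) (g 1) (g 1) (g 2) ∎
  5*conv≈closedForm {g} g-fib (suc (suc n)) = begin
    φ (+ 5) ⊛ conv g g (2 ℕ.+ n)
      ≈⟨ *-congˡ (conv-recurrence g-fib g-fib n) ⟩
    φ (+ 5) ⊛ (conv g g (1 ℕ.+ n) ⊕ conv g g n ⊕ r)
      ≈⟨ trans (distribˡ _ _ _) (+-congʳ (distribˡ _ _ _)) ⟩
    φ (+ 5) ⊛ conv g g (1 ℕ.+ n) ⊕ φ (+ 5) ⊛ conv g g n ⊕ φ (+ 5) ⊛ r
      -- The hypothesis at `suc n` mentions `g (2 ℕ.+ n)`, which must become `q ⊕ p` before
      -- `closedForm-recurrence` fits.
      ≈⟨ +-congʳ (+-cong
           (trans (5*conv≈closedForm g-fib (suc n)) (closedForm-cong (suc n) a b refl (g-fib n)))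
           (5*conv≈closedForm g-fib n)) ⟩
    closedForm (1 ℕ.+ n) a b q (q ⊕ p) ⊕ closedForm n a b p q ⊕ φ (+ 5) ⊛ r
      ≈⟨ closedForm-recurrence n a b p q ⟨
    closedForm (2 ℕ.+ n) a b (q ⊕ p) ((q ⊕ p) ⊕ q)
      ≈⟨ closedForm-cong (2 ℕ.+ n) a b (g-fib n)
           (trans (g-fib (1 ℕ.+ n)) (+-congʳ (g-fib n))) ⟨
    closedForm (2 ℕ.+ n) a b (g (2 ℕ.+ n)) (g (3 ℕ.+ n)) ∎
    where
    a b p q r : A
    a = g 0
    b = g 1
    p = g n
    q = g (1 ℕ.+ n)
    r = a ⊛ p ⊕ b ⊛ q

  conv≈closedForm/5 : ∀ {x g} → x ⊛ φ (+ 5) ≈ᴿ 1# → IsFibonacci g → ∀ n →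
    conv g g n ≈ᴿ x ⊛ closedForm n (g 0) (g 1) (g n) (g (1 ℕ.+ n))
  conv≈closedForm/5 {x} {g} x*5≈1 g-fib n = begin
    conv g g n                 ≈⟨ *-identityˡ _ ⟨
    1# ⊛ conv g g n            ≈⟨ *-congʳ x*5≈1 ⟨
    x ⊛ φ (+ 5) ⊛ conv g g n   ≈⟨ *-assoc _ _ _ ⟩
    x ⊛ (φ (+ 5) ⊛ conv g g n) ≈⟨ *-congˡ (5*conv≈closedForm g-fib n) ⟩
    x ⊛ closedForm n (g 0) (g 1) (g n) (g (1 ℕ.+ n)) ∎

-- The ring homomorphism from the integers to the complex numbers

private
  module ℂ = CommutativeRing ℂ-commutativeRing

-- Reduction to lowest terms is stuck on variables; among unnormalised fractions the claim is a
-- cross-multiplied integer identity.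
/1-homo-+ : ∀ i j → (i ℤ.+ j) ℚ./ 1 ≡ i ℚ./ 1 ℚ.+ j ℚ./ 1
/1-homo-+ i j = ℚ.toℚᵘ-injective (begin
  ℚ.toℚᵘ ((i ℤ.+ j) ℚ./ 1)                ≈⟨ ℚ.toℚᵘ-fromℚᵘ (ℚᵘ.mkℚᵘ (i ℤ.+ j) 0) ⟩
  ℚᵘ.mkℚᵘ (i ℤ.+ j) 0                     ≈⟨ ℚᵘ.*≡* (solve 2 (λ i j →
                                               (i :+ j) :* con (+ 1) :=
                                               (i :* con (+ 1) :+ j :* con (+ 1)) :* con (+ 1))
                                             ≡.refl i j) ⟩
  ℚᵘ.mkℚᵘ i 0 ℚᵘ.+ ℚᵘ.mkℚᵘ j 0            ≈⟨ ℚᵘ.+-cong (ℚ.toℚᵘ-fromℚᵘ (ℚᵘ.mkℚᵘ i 0))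
                                                       (ℚ.toℚᵘ-fromℚᵘ (ℚᵘ.mkℚᵘ j 0)) ⟨
  ℚ.toℚᵘ (i ℚ./ 1) ℚᵘ.+ ℚ.toℚᵘ (j ℚ./ 1)  ≈⟨ ℚ.toℚᵘ-homo-+ (i ℚ./ 1) (j ℚ./ 1) ⟨
  ℚ.toℚᵘ (i ℚ./ 1 ℚ.+ j ℚ./ 1)            ∎)
  where
  open SetoidReasoning ℚᵘ.≃-setoid
  open +-*-Solver

/1-homo-* : ∀ i j → (i ℤ.* j) ℚ./ 1 ≡ (i ℚ./ 1) ℚ.* (j ℚ./ 1)
/1-homo-* i j = ℚ.toℚᵘ-injective (begin
  ℚ.toℚᵘ ((i ℤ.* j) ℚ./ 1)                ≈⟨ ℚ.toℚᵘ-fromℚᵘ (ℚᵘ.mkℚᵘ (i ℤ.* j) 0) ⟩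
  ℚᵘ.mkℚᵘ i 0 ℚᵘ.* ℚᵘ.mkℚᵘ j 0            ≈⟨ ℚᵘ.*-cong (ℚ.toℚᵘ-fromℚᵘ (ℚᵘ.mkℚᵘ i 0))
                                                       (ℚ.toℚᵘ-fromℚᵘ (ℚᵘ.mkℚᵘ j 0)) ⟨
  ℚ.toℚᵘ (i ℚ./ 1) ℚᵘ.* ℚ.toℚᵘ (j ℚ./ 1)  ≈⟨ ℚ.toℚᵘ-homo-* (i ℚ./ 1) (j ℚ./ 1) ⟨
  ℚ.toℚᵘ ((i ℚ./ 1) ℚ.* (j ℚ./ 1))            ∎)
  where open SetoidReasoning ℚᵘ.≃-setoid

/1-homo‿- : ∀ i → (ℤ.- i) ℚ./ 1 ≡ ℚ.- (i ℚ./ 1)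
/1-homo‿- i = ℚ.toℚᵘ-injective (begin
  ℚ.toℚᵘ ((ℤ.- i) ℚ./ 1)    ≈⟨ ℚ.toℚᵘ-fromℚᵘ (ℚᵘ.mkℚᵘ (ℤ.- i) 0) ⟩
  ℚᵘ.- ℚᵘ.mkℚᵘ i 0          ≈⟨ ℚᵘ.-‿cong (ℚ.toℚᵘ-fromℚᵘ (ℚᵘ.mkℚᵘ i 0)) ⟨
  ℚᵘ.- ℚ.toℚᵘ (i ℚ./ 1)     ≈⟨ ℚ.toℚᵘ-homo‿- (i ℚ./ 1) ⟨
  ℚ.toℚᵘ (ℚ.- (i ℚ./ 1))    ∎)
  where open SetoidReasoning ℚᵘ.≃-setoid

pointwise⇒≃ᴿ : ∀ {x y} → (∀ n → ℝ.seq x n ≡ ℝ.seq y n) → x ≃ᴿ y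
pointwise⇒≃ᴿ {x} {y} x≗y = mk≃ λ ε ε>0 → 0 , λ n _ → ≡.subst (ℚ._< ε)
  (≡.sym (≡.cong ℚ.∣_∣
    (≡.trans (≡.cong (ℚ._- ℝ.seq y n) (x≗y n)) (ℚ.+-inverseʳ (ℝ.seq y n)))))
  ε>0

fromℚ-homo-+ : ∀ p q → fromℚ (p ℚ.+ q) ≈ fromℚ p + fromℚ q
fromℚ-homo-+ p q =
  pointwise⇒≃ᴿ (λ _ → ≡.refl) AdjoinI., pointwise⇒≃ᴿ (λ _ → ≡.refl)

fromℚ-homo-* : ∀ p q → fromℚ (p ℚ.* q) ≈ fromℚ p * fromℚ q
fromℚ-homo-* p q =
              -- The real part of the product carries the extra summand -(0 · 0), which computes to
              -- 0.
              pointwise⇒≃ᴿ (λ _ → ≡.sym (ℚ.+-identityʳ (p ℚ.* q)))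
  AdjoinI., pointwise⇒≃ᴿ (λ _ → ≡.sym (≡.cong₂ ℚ._+_ (ℚ.*-zeroʳ p) (ℚ.*-zeroˡ q)))

fromℚ-homo‿- : ∀ p → fromℚ (ℚ.- p) ≈ - fromℚ p
fromℚ-homo‿- p =
  pointwise⇒≃ᴿ (λ _ → ≡.refl) AdjoinI., pointwise⇒≃ᴿ (λ _ → ≡.refl)

fromℤ-morphism : ℤ.+-*-rawRing -Raw-AlmostCommutative⟶ fromCommutativeRing ℂ-commutativeRing
fromℤ-morphism = record
  { ⟦_⟧    = fromℤ
  ; +-homo = λ i j → ℂ.trans (ℂ.reflexive (≡.cong fromℚ (/1-homo-+ i j)))
                             (fromℚ-homo-+ (i ℚ./ 1) (j ℚ./ 1))
  ; *-homo = λ i j → ℂ.trans (ℂ.reflexive (≡.cong fromℚ (/1-homo-* i j)))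
                             (fromℚ-homo-* (i ℚ./ 1) (j ℚ./ 1))
  ; -‿homo = λ i → ℂ.trans (ℂ.reflexive (≡.cong fromℚ (/1-homo‿- i)))
                           (fromℚ-homo‿- (i ℚ./ 1))
  ; 0-homo = ℂ.refl
  ; 1-homo = ℂ.refl
  }

-- Specialisation to complex sequences indexed by ℤ

open Convolution ℂ-commutativeRing fromℤ-morphism
open SemiringSum ℂ-semiring using (sum-cong-≋)

+m-+n≡+[m∸n] : ∀ {m n} → n ℕ.≤ m → + m ℤ.- + n ≡ + (m ∸ n)
+m-+n≡+[m∸n] {m} {n} n≤m = ≡.trans (ℤ.m-n≡m⊖n m n) (ℤ.⊖-≥ n≤m)

fibonacci-restrict : ∀ {G} → IsGeneralizedFibonacci G → IsFibonacci (G ∘ +_)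
fibonacci-restrict {G} G-fib n =
  -- `+ n ℤ.+ + 2` computes to `+ (n ℕ.+ 2)`, so only the order of the summands differs.
  ≡.subst₂ (λ i j → G (+ i) ≈ G (+ j) + G (+ n)) (ℕ.+-comm n 2) (ℕ.+-comm n 1) (G-fib (+ n))

mainTheorem9 : (G : ℤ → ℂ) → IsGeneralizedFibonacci G → (n : ℕ) →
    (∑[ k ≤ n ] (G (+ toℕ k) * G (+ n ℤ.- + toℕ k))) ≈
    fromℚ (+ 1 ℚ./ 5) *
    (   (fromℤ (+ 3 ℤ.* + n ℤ.+ + 5) * G (+ 0) - fromℤ (+ n ℤ.+ + 1) * G (+ 1)) * G (+ n)
    - (fromℤ (+ n ℤ.- + 1) * G (+ 0) - fromℤ (+ 2 ℤ.* + n) * G (+ 1)) * G (+ n ℤ.+ + 1) )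
mainTheorem9 G G-fib n = begin
  (∑[ k ≤ n ] (G (+ toℕ k) * G (+ n ℤ.- + toℕ k)))
    ≈⟨ sum-cong-≋ {n = suc n} (λ k → ℂ.*-congˡ {G (+ toℕ k)}
         (ℂ.reflexive (≡.cong G (+m-+n≡+[m∸n] (toℕ≤pred[n] k))))) ⟩
  conv (G ∘ +_) (G ∘ +_) n
    -- The rational product 1/5 · 5 evaluates to `1ℚ`, so multiplicativity of `fromℚ` already says
    -- that 1/5 inverts 5 in ℂ.
    ≈⟨ conv≈closedForm/5 (ℂ.sym (fromℚ-homo-* (+ 1 ℚ./ 5) (+ 5 ℚ./ 1)))
         (fibonacci-restrict G-fib) n ⟩
  fromℚ (+ 1 ℚ./ 5) * closedForm n (G (+ 0)) (G (+ 1)) (G (+ n)) (G (+ (1 ℕ.+ n)))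
    ≈⟨ ℂ.*-congˡ (closedForm-cong n (G (+ 0)) (G (+ 1)) ℂ.refl
         (ℂ.reflexive (≡.cong (G ∘ +_) (ℕ.+-comm 1 n)))) ⟩
  fromℚ (+ 1 ℚ./ 5) * closedForm n (G (+ 0)) (G (+ 1)) (G (+ n)) (G (+ n ℤ.+ + 1)) ∎
  where open SetoidReasoning ℂ.setoid
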